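{- $\displaystyle\liminf_{A\to\infty}\frac{\#\mathbb{L}^{\mathrm{loc}}(A)}{\#\mathbb{L}(A)}>0.$
   Context: For $\mathbf{x}\in\mathbb{R}^4$ let $\|\mathbf{x}\|$ be the Euclidean norm. Let $\mathbb{Z}^4_{\mathrm{prim}}$ be the set of tuples $\mathbf{a}=(a_1,\dots,a_4)$ of non-zero integers with $\gcd(a_1,a_2,a_3,a_4)=1$, and $\mathbb{L}(A)=\{\mathbf{a}\in\mathbb{Z}^4_{\mathrm{prim}}:\|\mathbf{a}\|\leq A\}$. A tuple $\mathbf{a}\in\mathbb{Z}^4_{\mathrm{prim}}$ is locally solvable if its coordinates are not all of the same sign and for every prime $p$ there exist integers $x_1,\dots,x_4$, none divisible by $p$, with $a_1x_1+\dots+a_4x_4\equiv 0\pmod p$. $\mathbb{L}^{\mathrm{loc}}(A)$ is the set of locally solvable $\mathbf{a}\in\mathbb{Z}^4_{\mathrm{prim}}$ with $\|\mathbf{a}\|\leq A$. -}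

module Defs where

open import Data.Nat as ℕ using (ℕ)
open import Data.Nat.Primality using (Prime)
open import Data.Integer as ℤ using (ℤ; +_; 0ℤ; 1ℤ)
open import Data.Integer.Divisibility using (_∣_)
open import Data.Integer.GCD using (gcd)
open import Data.Fin using (Fin)
open import Data.Vec using (Vec; lookup)
open import Data.List using (List; length)
open import Data.List.Membership.Propositional using (_∈_)
open import Data.List.Relation.Unary.Unique.Propositional using (Unique)
open import Data.Product using (Σ; ∃; ∃-syntax; _×_; _,_)
open import Function.Bundles using (_⇔_)
open import Relation.Nullary using (¬_)
open import Relation.Binary.PropositionalEquality using (_≡_)

Tuple : Set
Tuple = Vec ℤ 4

_⟦_⟧ : Tuple → Fin 4 → ℤ
a ⟦ i ⟧ = lookup a i

normSq : Tuple → ℤ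
normSq a = a ⟦ Fin.zero ⟧ ℤ.* a ⟦ Fin.zero ⟧
       ℤ.+ a ⟦ Fin.suc Fin.zero ⟧ ℤ.* a ⟦ Fin.suc Fin.zero ⟧
       ℤ.+ a ⟦ Fin.suc (Fin.suc Fin.zero) ⟧ ℤ.* a ⟦ Fin.suc (Fin.suc Fin.zero) ⟧
       ℤ.+ a ⟦ Fin.suc (Fin.suc (Fin.suc Fin.zero)) ⟧ ℤ.* a ⟦ Fin.suc (Fin.suc (Fin.suc Fin.zero)) ⟧
  where open import Data.Fin as Fin using ()

linForm : Tuple → Tuple → ℤ
linForm a x = a ⟦ Fin.zero ⟧ ℤ.* x ⟦ Fin.zero ⟧
       ℤ.+ a ⟦ Fin.suc Fin.zero ⟧ ℤ.* x ⟦ Fin.suc Fin.zero ⟧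
       ℤ.+ a ⟦ Fin.suc (Fin.suc Fin.zero) ⟧ ℤ.* x ⟦ Fin.suc (Fin.suc Fin.zero) ⟧
       ℤ.+ a ⟦ Fin.suc (Fin.suc (Fin.suc Fin.zero)) ⟧ ℤ.* x ⟦ Fin.suc (Fin.suc (Fin.suc Fin.zero)) ⟧
  where open import Data.Fin as Fin using ()

gcd4 : Tuple → ℤ
gcd4 a = gcd (gcd (gcd (a ⟦ Fin.zero ⟧) (a ⟦ Fin.suc Fin.zero ⟧))
                  (a ⟦ Fin.suc (Fin.suc Fin.zero) ⟧))
             (a ⟦ Fin.suc (Fin.suc (Fin.suc Fin.zero)) ⟧)
  where open import Data.Fin as Fin using ()

Prim : Tuple → Set
Prim a = (∀ i → ¬ (a ⟦ i ⟧ ≡ 0ℤ)) × (gcd4 a ≡ 1ℤ)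

NotAllSameSign : Tuple → Set
NotAllSameSign a = ∃[ i ] ∃[ j ] ((a ⟦ i ⟧ ℤ.< 0ℤ) × (0ℤ ℤ.< a ⟦ j ⟧))

SolvableMod : ℕ → Tuple → Set
SolvableMod p a = ∃[ x ] ((∀ i → ¬ ((+ p) ∣ (x ⟦ i ⟧))) × ((+ p) ∣ linForm a x))

LocSolv : Tuple → Set
LocSolv a = NotAllSameSign a × (∀ p → Prime p → SolvableMod p a)

-- ‖a‖ ≤ A  is equivalent to  normSq a ≤ A²; since normSq a is an integer
-- the sets only depend on N = ⌊A²⌋, so we index by N : ℕ.
BoxN : ℕ → Tuple → Set
BoxN N a = normSq a ℤ.≤ + N

𝕃 : ℕ → Tuple → Set
𝕃 N a = Prim a × BoxN N a

𝕃loc : ℕ → Tuple → Set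
𝕃loc N a = (Prim a × LocSolv a) × BoxN N a

HasCard : (Tuple → Set) → ℕ → Set
HasCard P k = Σ (List Tuple) λ xs →
  Unique xs × (∀ a → (a ∈ xs) ⇔ P a) × (length xs ≡ k)

{-# OPTIONS --safe #-}
-- If a, b are coprime and c, d are coprime, then every prime leaves a unit in each of the two pairs.
-- This makes a x + b y = c z + d w solvable in units modulo every odd prime, and modulo 2 as soon as
-- a + b ≡ c + d. By a union bound over the common factor g ≥ 2, at least a third of the pairs in
-- [1, m]² are coprime, because the sum of 1/g² over g ≥ 2 is at most 2/3. One of the two parity
-- classes of a + b contains half of them, and two pairs from this class give a locally solvable tuple
-- (a, b, -c, -d). So there are at least (m²/6)² such tuples of norm at most 2 m, against at most
-- (4 m + 3)⁴ integer tuples of norm less than 2 (m + 1).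
module Submission where

open import Defs
open import Data.Nat using (ℕ; _*_; _≤_; _<_)
open import Data.Product using (Σ; ∃-syntax; _×_)

-- Solvability in units modulo a prime.

module Solvability where

  import Data.Nat.Divisibility as ℕ
  open import Data.Nat.Primality using (Prime; euclidsLemma; ¬prime[1]; prime⇒irreducible; prime[2])
  open import Data.Integer using (ℤ; +_; -_; _+_; _-_; ∣_∣; 1ℤ) renaming (_*_ to _⋆_)
  open import Data.Integer.Properties using (∣-i∣≡∣i∣; abs-*)
  open import Data.Integer.Divisibility using (_∣_)
  open import Data.Integer.Divisibility.Signed using (∣ᵤ⇒∣; ∣⇒∣ᵤ; ∣m∣n⇒∣m+n; ∣m∣n⇒∣m-n)
  open import Data.Integer.Tactic.RingSolver using (solve-∀)
  open import Data.Fin using (zero; suc)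
  open import Data.Vec using (_∷_; []; lookup)
  open import Data.Product using (_,_)
  open import Data.Sum using (inj₁; inj₂)
  open import Relation.Nullary using (¬_; yes; no; contradiction)
  open import Relation.Binary.PropositionalEquality using (_≡_; refl; sym; subst)

  ∣-+ : ∀ {p} i j → + p ∣ i → + p ∣ j → + p ∣ i + j
  ∣-+ {p} i j p∣i p∣j = ∣⇒∣ᵤ (∣m∣n⇒∣m+n (∣ᵤ⇒∣ {+ p} {i} p∣i) (∣ᵤ⇒∣ {+ p} {j} p∣j))

  ∣-− : ∀ {p} i j → + p ∣ i → + p ∣ j → + p ∣ i - j
  ∣-− {p} i j p∣i p∣j = ∣⇒∣ᵤ (∣m∣n⇒∣m-n (∣ᵤ⇒∣ {+ p} {i} p∣i) (∣ᵤ⇒∣ {+ p} {j} p∣j))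

  ∣-neg⁻ : ∀ {p} i → + p ∣ - i → + p ∣ i
  ∣-neg⁻ {p} i = subst (p ℕ.∣_) (∣-i∣≡∣i∣ i)

  euclidℤ : ∀ {p} → Prime p → ∀ i j → ¬ (+ p ∣ i) → + p ∣ i ⋆ j → + p ∣ j
  euclidℤ {p} pp i j p∤i p∣ij with euclidsLemma ∣ i ∣ ∣ j ∣ pp (subst (p ℕ.∣_) (abs-* i j) p∣ij)
  ... | inj₁ p∣i = contradiction p∣i p∤i
  ... | inj₂ p∣j = p∣j

  prime∤1 : ∀ {p} → Prime p → ¬ (p ℕ.∣ 1)
  prime∤1 pp p∣1 = ¬prime[1] (subst Prime (ℕ.∣1⇒≡1 p∣1) pp)

  solution : ∀ {p} a b c d x y z w →
             ¬ (+ p ∣ x) → ¬ (+ p ∣ y) → ¬ (+ p ∣ z) → ¬ (+ p ∣ w) →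
             + p ∣ a ⋆ x + b ⋆ y + c ⋆ z + d ⋆ w → SolvableMod p (a ∷ b ∷ c ∷ d ∷ [])
  solution {p} a b c d x y z w p∤x p∤y p∤z p∤w p∣form = xs , units , p∣form
    where
    xs = x ∷ y ∷ z ∷ w ∷ []
    units : ∀ i → ¬ (+ p ∣ lookup xs i)
    units zero                   = p∤x
    units (suc zero)             = p∤y
    units (suc (suc zero))       = p∤z
    units (suc (suc (suc zero))) = p∤w

  -- Together with `exchange-pairs`, this moves a unit coefficient to the front of its pair and
  -- either pair to the front of the tuple, so that the case analysis can work with fixed positions.
  swap-first-pair : ∀ {p} a b c d → SolvableMod p (b ∷ a ∷ c ∷ d ∷ []) → SolvableMod p (a ∷ b ∷ c ∷ d ∷ [])
  swap-first-pair {p} a b c d (x ∷ y ∷ z ∷ w ∷ [] , u , p∣form) =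
    solution a b c d y x z w (u (suc zero)) (u zero) (u (suc (suc zero))) (u (suc (suc (suc zero))))
      (subst (+ p ∣_) (identity a b c d x y z w) p∣form)
    where
    identity : ∀ a b c d x y z w → b ⋆ x + a ⋆ y + c ⋆ z + d ⋆ w ≡ a ⋆ y + b ⋆ x + c ⋆ z + d ⋆ w
    identity = solve-∀

  exchange-pairs : ∀ {p} a b c d → SolvableMod p (c ∷ d ∷ a ∷ b ∷ []) → SolvableMod p (a ∷ b ∷ c ∷ d ∷ [])
  exchange-pairs {p} a b c d (x ∷ y ∷ z ∷ w ∷ [] , u , p∣form) =
    solution a b c d z w x y (u (suc (suc zero))) (u (suc (suc (suc zero)))) (u zero) (u (suc zero))
      (subst (+ p ∣_) (identity a b c d x y z w) p∣form)
    where
    identity : ∀ a b c d x y z w → c ⋆ x + d ⋆ y + a ⋆ z + b ⋆ w ≡ a ⋆ z + b ⋆ w + c ⋆ x + d ⋆ y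
    identity = solve-∀

  module _ {p} (pp : Prime p) where

    private
      p∤1 : ¬ (+ p ∣ 1ℤ)
      p∤1 = prime∤1 pp

    -- The vector (b, -a, d, -c) is an exact integer zero of the form, and its entries are units
    -- because the coefficients are.
    solvable-units : ∀ a b c d → ¬ (+ p ∣ a) → ¬ (+ p ∣ b) → ¬ (+ p ∣ c) → ¬ (+ p ∣ d) →
                     SolvableMod p (a ∷ b ∷ c ∷ d ∷ [])
    solvable-units a b c d p∤a p∤b p∤c p∤d =
      solution a b c d b (- a) d (- c) p∤b (λ h → p∤a (∣-neg⁻ a h)) p∤d (λ h → p∤c (∣-neg⁻ c h))
        (subst (+ p ∣_) (identity a b c d) (p ℕ.∣0))
      where
      identity : ∀ a b c d → + 0 ≡ a ⋆ b + b ⋆ (- a) + c ⋆ d + d ⋆ (- c)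
      identity = solve-∀

    -- One of a + b, a - b is a unit modulo an odd prime, since they add up to 2 a.
    solvable-three-units : ¬ (p ℕ.∣ 2) → ∀ a b c d → ¬ (+ p ∣ a) → ¬ (+ p ∣ b) → ¬ (+ p ∣ c) → + p ∣ d →
                           SolvableMod p (a ∷ b ∷ c ∷ d ∷ [])
    solvable-three-units p∤2 a b c d p∤a p∤b p∤c p∣d with p ℕ.∣? ∣ a + b ∣
    ... | no p∤a+b =
      solution a b c d c c (- (a + b)) 1ℤ p∤c p∤c (λ h → p∤a+b (∣-neg⁻ (a + b) h)) p∤1
        (subst (+ p ∣_) (identity a b c d) p∣d)
      where
      identity : ∀ a b c d → d ≡ a ⋆ c + b ⋆ c + c ⋆ (- (a + b)) + d ⋆ 1ℤ
      identity = solve-∀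
    ... | yes p∣a+b =
      solution a b c d c (- c) (- (a - b)) 1ℤ p∤c (λ h → p∤c (∣-neg⁻ c h)) (λ h → p∤a-b (∣-neg⁻ (a - b) h)) p∤1
        (subst (+ p ∣_) (identity a b c d) p∣d)
      where
      identity : ∀ a b c d → d ≡ a ⋆ c + b ⋆ (- c) + c ⋆ (- (a - b)) + d ⋆ 1ℤ
      identity = solve-∀
      sum≡2a : ∀ a b → (a + b) + (a - b) ≡ + 2 ⋆ a
      sum≡2a = solve-∀
      p∤a-b : ¬ (+ p ∣ a - b)
      p∤a-b p∣a-b = p∤a (euclidℤ pp (+ 2) a p∤2
        (subst (+ p ∣_) (sum≡2a a b) (∣-+ (a + b) (a - b) p∣a+b p∣a-b)))

    -- Taking c and -a at the two unit coefficients cancels their terms; ones elsewhere leave b + d,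
    -- which p divides.
    solvable-two-units : ∀ a b c d → ¬ (+ p ∣ a) → + p ∣ b → ¬ (+ p ∣ c) → + p ∣ d →
                         SolvableMod p (a ∷ b ∷ c ∷ d ∷ [])
    solvable-two-units a b c d p∤a p∣b p∤c p∣d =
      solution a b c d c 1ℤ (- a) 1ℤ p∤c p∤1 (λ h → p∤a (∣-neg⁻ a h)) p∤1
        (subst (+ p ∣_) (identity a b c d) (∣-+ b d p∣b p∣d))
      where
      identity : ∀ a b c d → b + d ≡ a ⋆ c + b ⋆ 1ℤ + c ⋆ (- a) + d ⋆ 1ℤ
      identity = solve-∀

    module _ (p∤2 : ¬ (p ℕ.∣ 2)) where

      -- Divisibility of b and d decides whether four, three or two coefficients are units. If b is
      -- the only non-unit, exchanging the pairs brings it to the last place.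
      solvable-leading-units : ∀ a b c d → ¬ (+ p ∣ a) → ¬ (+ p ∣ c) → SolvableMod p (a ∷ b ∷ c ∷ d ∷ [])
      solvable-leading-units a b c d p∤a p∤c with p ℕ.∣? ∣ b ∣ | p ℕ.∣? ∣ d ∣
      ... | no p∤b  | no p∤d  = solvable-units a b c d p∤a p∤b p∤c p∤d
      ... | no p∤b  | yes p∣d = solvable-three-units p∤2 a b c d p∤a p∤b p∤c p∣d
      ... | yes p∣b | no p∤d  = exchange-pairs a b c d (solvable-three-units p∤2 c d a b p∤c p∤d p∤a p∣b)
      ... | yes p∣b | yes p∣d = solvable-two-units a b c d p∤a p∣b p∤c p∣d

      solvable-leading-unit : ∀ a b c d → ¬ (+ p ∣ a) → ¬ ((+ p ∣ c) × (+ p ∣ d)) → SolvableMod p (a ∷ b ∷ c ∷ d ∷ [])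
      solvable-leading-unit a b c d p∤a p∤cd with p ℕ.∣? ∣ c ∣
      ... | no p∤c  = solvable-leading-units a b c d p∤a p∤c
      -- Now d is the unit of its pair; the reordering (d, c, a, b) has units in the first and third
      -- places.
      ... | yes p∣c = exchange-pairs a b c d (swap-first-pair c d a b
                        (solvable-leading-units d c a b (λ p∣d → p∤cd (p∣c , p∣d)) p∤a))

      solvable-odd : ∀ a b c d → ¬ ((+ p ∣ a) × (+ p ∣ b)) → ¬ ((+ p ∣ c) × (+ p ∣ d)) → SolvableMod p (a ∷ b ∷ c ∷ d ∷ [])
      solvable-odd a b c d p∤ab p∤cd with p ℕ.∣? ∣ a ∣
      ... | no p∤a  = solvable-leading-unit a b c d p∤a p∤cd
      ... | yes p∣a = swap-first-pair a b c d (solvable-leading-unit b a c d (λ p∣b → p∤ab (p∣a , p∣b)) p∤cd)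

  prime∣2⇒≡2 : ∀ {p} → Prime p → p ℕ.∣ 2 → p ≡ 2
  prime∣2⇒≡2 pp p∣2 with prime⇒irreducible prime[2] p∣2
  ... | inj₁ refl = contradiction pp ¬prime[1]
  ... | inj₂ p≡2  = p≡2

  -- All units are congruent to 1 modulo 2, so the all-ones vector is the only candidate, and there
  -- the form is the sum of the coefficients.
  solvable-2 : ∀ a b c d → + 2 ∣ a + b + c + d → SolvableMod 2 (a ∷ b ∷ c ∷ d ∷ [])
  solvable-2 a b c d 2∣sum =
    solution a b c d 1ℤ 1ℤ 1ℤ 1ℤ 2∤1 2∤1 2∤1 2∤1 (subst (+ 2 ∣_) (identity a b c d) 2∣sum)
    where
    2∤1 = prime∤1 prime[2]
    identity : ∀ a b c d → a + b + c + d ≡ a ⋆ 1ℤ + b ⋆ 1ℤ + c ⋆ 1ℤ + d ⋆ 1ℤ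
    identity = solve-∀

  solvable : ∀ {p} → Prime p → ∀ a b c d → + 2 ∣ a + b + c + d →
             ¬ ((+ p ∣ a) × (+ p ∣ b)) → ¬ ((+ p ∣ c) × (+ p ∣ d)) → SolvableMod p (a ∷ b ∷ c ∷ d ∷ [])
  solvable {p} pp a b c d 2∣sum p∤ab p∤cd with p ℕ.∣? 2
  ... | no p∤2  = solvable-odd pp p∤2 a b c d p∤ab p∤cd
  ... | yes p∣2 = subst (λ q → SolvableMod q (a ∷ b ∷ c ∷ d ∷ [])) (sym (prime∣2⇒≡2 pp p∣2))
                    (solvable-2 a b c d 2∣sum)

open Solvability using (∣-−; prime∤1; solvable)

open import Data.Nat hiding (_/_)
open import Data.Nat.Properties
open import Data.Nat.DivMod using (_/_; m/n*n≤m; m*n/n≡m; /-monoˡ-≤)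
open import Data.Nat.Divisibility using (_∣_; divides; _∣?_; 0∣⇒≡0; ∣⇒≤; ∣-refl)
open import Data.Nat.Coprimality using (Coprime; coprime?; coprime⇒gcd≡1; gcd≡1⇒coprime)
open import Data.Nat.GCD using (gcd; gcd[m,n]∣m; gcd[m,n]∣n; gcd-zeroˡ)
open import Data.Nat.Primality using (Prime)
open import Data.Nat.Tactic.RingSolver using (solve-∀)
open import Data.Fin using (zero; suc)
open import Data.Vec using (Vec; []; _∷_; lookup)
open import Data.List using (List; []; _∷_; _++_; map; length; upTo; cartesianProduct; cartesianProductWith; filter)
open import Data.List.Properties using (length-++; length-map; length-upTo)
open import Data.List.Membership.Propositional using (_∈_)
open import Data.List.Membership.Propositional.Properties
open import Data.List.Relation.Unary.Any using (here; there)
import Data.List.Relation.Unary.All as All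
open import Data.List.Relation.Unary.AllPairs using ([]; _∷_)
open import Data.List.Relation.Unary.Unique.Propositional using (Unique)
import Data.List.Relation.Unary.Unique.Propositional.Properties as Unique
open import Data.Empty using (⊥-elim)
open import Data.Product using (_,_; proj₁; proj₂)
open import Data.Sum using (_⊎_; inj₁; inj₂)
open import Function using (_∘_)
open import Function.Bundles using (Equivalence)
open import Relation.Nullary using (¬_; yes; no; contradiction; Dec; _×-dec_)
open import Relation.Binary.PropositionalEquality

-- Comparing lengths of lists.

length-cartesianProductWith : ∀ {a b c} {A : Set a} {B : Set b} {C : Set c} (f : A → B → C) xs ys →
                              length (cartesianProductWith f xs ys) ≡ length xs * length ys
length-cartesianProductWith f []       ys = refl
length-cartesianProductWith f (x ∷ xs) ys = trans (length-++ (map (f x) ys))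
  (cong₂ _+_ (length-map (f x) ys) (length-cartesianProductWith f xs ys))

-- Induction on `xs`: its head is cut out of `ys`, and uniqueness keeps the tail inside what is
-- left. Since `ys` may contain repetitions, this also serves as the union bound for an overlapping
-- cover.
length-⊆ : ∀ {a} {A : Set a} {xs ys : List A} → Unique xs → (∀ {x} → x ∈ xs → x ∈ ys) → length xs ≤ length ys
length-⊆ {xs = []}     _          _     = z≤n
length-⊆ {xs = x ∷ xs} (x∉ ∷ uxs) xs⊆ys with ∈-∃++ (xs⊆ys (here refl))
... | as , bs , refl = begin
  suc (length xs)             ≤⟨ s≤s (length-⊆ uxs xs⊆as++bs) ⟩
  suc (length (as ++ bs))     ≡⟨ cong suc (length-++ as) ⟩
  suc (length as + length bs) ≡⟨ +-suc (length as) (length bs) ⟨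
  length as + length (x ∷ bs) ≡⟨ length-++ as ⟨
  length (as ++ x ∷ bs)       ∎
  where
  open ≤-Reasoning
  xs⊆as++bs : ∀ {z} → z ∈ xs → z ∈ as ++ bs
  xs⊆as++bs z∈xs with ∈-++⁻ as (xs⊆ys (there z∈xs))
  ... | inj₁ z∈as         = ∈-++⁺ˡ z∈as
  ... | inj₂ (there z∈bs) = ∈-++⁺ʳ as z∈bs
  ... | inj₂ (here refl)  = contradiction refl (All.lookup x∉ z∈xs)

-- Pairs with a common factor.

-- Entries x stand for the positive integer 1 + x and indices j for the common factor 2 + j.

square : ℕ → List (ℕ × ℕ)
square m = cartesianProduct (upTo m) (upTo m)

length-square : ∀ m → length (square m) ≡ m * m
length-square m = trans (length-cartesianProductWith _,_ (upTo m) (upTo m))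
  (cong₂ _*_ (length-upTo m) (length-upTo m))

-- The entry at q is one less than (1 + q) (2 + j), so it stands for that multiple of 2 + j.
multiples : ℕ → ℕ → List ℕ
multiples m j = map (λ q → suc j + q * suc (suc j)) (upTo (m / suc (suc j)))

∈-multiples : ∀ {m x} j → x < m → suc (suc j) ∣ suc x → x ∈ multiples m j
∈-multiples {m} {x} j x<m (divides (suc q) refl) = ∈-map⁺ _ (∈-upTo⁺ (begin
  suc q                                ≡⟨ m*n/n≡m (suc q) (suc (suc j)) ⟨
  (suc q * suc (suc j)) / suc (suc j)  ≤⟨ /-monoˡ-≤ (suc (suc j)) x<m ⟩
  m / suc (suc j)                      ∎))
  where open ≤-Reasoning

-- A pair is listed once for each of its common factors g with 2 ≤ g ≤ n + 1, so the length is the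
-- sum of the squares of the floors of m/g.
commonMultiples : ℕ → ℕ → List (ℕ × ℕ)
commonMultiples m zero    = []
commonMultiples m (suc n) = cartesianProduct (multiples m n) (multiples m n) ++ commonMultiples m n

∈-commonMultiples : ∀ {m x y} n j → j < n → x < m → y < m →
                    suc (suc j) ∣ suc x → suc (suc j) ∣ suc y → (x , y) ∈ commonMultiples m n
∈-commonMultiples (suc n) j j<1+n x<m y<m d∣x d∣y with m≤n⇒m<n∨m≡n (≤-pred j<1+n)
... | inj₁ j<n  = ∈-++⁺ʳ _ (∈-commonMultiples n j j<n x<m y<m d∣x d∣y)
... | inj₂ refl = ∈-++⁺ˡ (∈-cartesianProduct⁺ (∈-multiples j x<m d∣x) (∈-multiples j y<m d∣y))

-- 1/g² ≤ 1/(g - 1/2) - 1/(g + 1/2), summed over 2 ≤ g ≤ n + 1.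
length-commonMultiples : ∀ m n → (3 * (2 * n + 3)) * length (commonMultiples m n) ≤ 4 * n * (m * m)
length-commonMultiples m zero    = z≤n
length-commonMultiples m (suc n) = *-cancelˡ-≤ (2 * n + 3) {{2n+3≢0}} (begin
  (2 * n + 3) * ((3 * (2 * suc n + 3)) * length (commonMultiples m (suc n)))
    ≡⟨ cong (λ l → (2 * n + 3) * ((3 * (2 * suc n + 3)) * l)) length-step ⟩
  (2 * n + 3) * ((3 * (2 * suc n + 3)) * (q * q + L))
    ≡⟨ expand n q L ⟩
  (2 * n + 5) * ((3 * (2 * n + 3)) * L) + (3 * ((2 * n + 3) * (2 * n + 5))) * (q * q)
    -- The new factor is g = n + 2, and (2 n + 3) (2 n + 5) = 4 g² - 1. Dropping the 1 is the
    -- inequality for 1/g² with its denominators cleared.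
    ≤⟨ +-mono-≤ (*-monoʳ-≤ (2 * n + 5) (length-commonMultiples m n))
                (*-monoˡ-≤ (q * q) (*-monoʳ-≤ 3 (≤-trans (n≤1+n _) (≤-reflexive (difference-of-squares n))))) ⟩
  (2 * n + 5) * (4 * n * (m * m)) + (3 * (4 * ((2 + n) * (2 + n)))) * (q * q)
    ≡⟨ cong (λ k → (2 * n + 5) * (4 * n * (m * m)) + k) (regroup n q) ⟩
  (2 * n + 5) * (4 * n * (m * m)) + 12 * (q * (2 + n) * (q * (2 + n)))
    ≤⟨ +-monoʳ-≤ ((2 * n + 5) * (4 * n * (m * m))) (*-monoʳ-≤ 12 (*-mono-≤ (m/n*n≤m m (2 + n)) (m/n*n≤m m (2 + n)))) ⟩
  (2 * n + 5) * (4 * n * (m * m)) + 12 * (m * m)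
    ≡⟨ collect n (m * m) ⟩
  (2 * n + 3) * (4 * suc n * (m * m)) ∎)
  where
  open ≤-Reasoning
  q = m / suc (suc n)
  L = length (commonMultiples m n)
  2n+3≢0 : NonZero (2 * n + 3)
  2n+3≢0 = subst NonZero (+-comm 3 (2 * n)) _
  length-multiples : length (multiples m n) ≡ q
  length-multiples = trans (length-map _ (upTo q)) (length-upTo q)
  length-step : length (commonMultiples m (suc n)) ≡ q * q + L
  length-step = trans (length-++ (cartesianProduct (multiples m n) (multiples m n)))
    (cong (_+ L) (trans (length-cartesianProductWith _,_ (multiples m n) (multiples m n))
      (cong₂ _*_ length-multiples length-multiples)))
  expand : ∀ n q L → (2 * n + 3) * ((3 * (2 * suc n + 3)) * (q * q + L)) ≡
                     (2 * n + 5) * ((3 * (2 * n + 3)) * L) + (3 * ((2 * n + 3) * (2 * n + 5))) * (q * q)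
  expand = solve-∀
  difference-of-squares : ∀ n → suc ((2 * n + 3) * (2 * n + 5)) ≡ 4 * ((2 + n) * (2 + n))
  difference-of-squares = solve-∀
  regroup : ∀ n q → (3 * (4 * ((2 + n) * (2 + n)))) * (q * q) ≡ 12 * (q * (2 + n) * (q * (2 + n)))
  regroup = solve-∀
  collect : ∀ n k → (2 * n + 5) * (4 * n * k) + 12 * k ≡ (2 * n + 3) * (4 * suc n * k)
  collect = solve-∀

-- The telescoped sum 4 n / (3 (2 n + 3)) stays below its limit 2/3, which makes the bound uniform
-- in n.
commonMultiples-bound : ∀ m n → 3 * length (commonMultiples m n) ≤ 2 * (m * m)
commonMultiples-bound m n = *-cancelˡ-≤ (3 + 2 * n) (begin
  (3 + 2 * n) * (3 * L)      ≡⟨ rearrange n L ⟩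
  (3 * (2 * n + 3)) * L      ≤⟨ length-commonMultiples m n ⟩
  4 * n * (m * m)            ≤⟨ m≤n+m _ (6 * (m * m)) ⟩
  6 * (m * m) + 4 * n * (m * m) ≡⟨ collect n (m * m) ⟩
  (3 + 2 * n) * (2 * (m * m)) ∎)
  where
  open ≤-Reasoning
  L = length (commonMultiples m n)
  rearrange : ∀ n L → (3 + 2 * n) * (3 * L) ≡ (3 * (2 * n + 3)) * L
  rearrange = solve-∀
  collect : ∀ n k → 6 * k + 4 * n * k ≡ (3 + 2 * n) * (2 * k)
  collect = solve-∀

-- Coprime pairs in one parity class.

-- The number r selects the parity class: 1 + x and 1 + y have a sum of the same parity as x + y.
-- Adding r inside the divisibility lets it cancel when two pairs of one class are subtracted.
Pair : ℕ → ℕ × ℕ → Set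
Pair r (x , y) = Coprime (suc x) (suc y) × 2 ∣ r + (x + y)

pair? : ∀ r xy → Dec (Pair r xy)
pair? r (x , y) = coprime? (suc x) (suc y) ×-dec (2 ∣? r + (x + y))

pairs : ℕ → ℕ → List (ℕ × ℕ)
pairs m r = filter (pair? r) (square m)

pairs-unique : ∀ m r → Unique (pairs m r)
pairs-unique m r = Unique.filter⁺ (pair? r) (Unique.cartesianProduct⁺ (Unique.upTo⁺ m) (Unique.upTo⁺ m))

∈-pairs⁻ : ∀ {m r x y} → (x , y) ∈ pairs m r → x < m × y < m × Pair r (x , y)
∈-pairs⁻ {m} {r} xy∈ with ∈-filter⁻ (pair? r) xy∈
... | xy∈□ , pair with ∈-cartesianProduct⁻ (upTo m) (upTo m) xy∈□
... | x∈ , y∈ = ∈-upTo⁻ x∈ , ∈-upTo⁻ y∈ , pair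

2∣n⊎2∣1+n : ∀ n → 2 ∣ n ⊎ 2 ∣ suc n
2∣n⊎2∣1+n zero = inj₁ (divides 0 refl)
2∣n⊎2∣1+n (suc n) with 2∣n⊎2∣1+n n
... | inj₁ (divides q refl) = inj₂ (divides (suc q) refl)
... | inj₂ 2∣1+n            = inj₁ 2∣1+n

¬coprime⇒common-factor : ∀ x y → ¬ Coprime (suc x) (suc y) → ∃[ j ] (suc (suc j) ∣ suc x × suc (suc j) ∣ suc y)
¬coprime⇒common-factor x y ¬cop with gcd (suc x) (suc y) in eq | gcd[m,n]∣m (suc x) (suc y) | gcd[m,n]∣n (suc x) (suc y)
... | zero        | 0∣x | _   = contradiction (0∣⇒≡0 0∣x) λ ()
... | suc zero    | _   | _   = ⊥-elim (¬cop (gcd≡1⇒coprime eq))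
... | suc (suc j) | d∣x | d∣y = j , d∣x , d∣y

square-covered : ∀ m {xy} → xy ∈ square m → xy ∈ (pairs m 0 ++ pairs m 1) ++ commonMultiples m m
square-covered m {x , y} xy∈ with coprime? (suc x) (suc y) | 2∣n⊎2∣1+n (x + y)
... | yes cop | inj₁ even = ∈-++⁺ˡ (∈-++⁺ˡ (∈-filter⁺ (pair? 0) xy∈ (cop , even)))
... | yes cop | inj₂ odd  = ∈-++⁺ˡ (∈-++⁺ʳ (pairs m 0) (∈-filter⁺ (pair? 1) xy∈ (cop , odd)))
... | no ¬cop | _ with ¬coprime⇒common-factor x y ¬cop | ∈-cartesianProduct⁻ (upTo m) (upTo m) xy∈
-- From 2 + j ≤ 1 + x ≤ m it follows that j < m, so the list of common factors up to m + 1 is long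
-- enough.
... | j , d∣x , d∣y | x∈ , y∈ = ∈-++⁺ʳ (pairs m 0 ++ pairs m 1)
        (∈-commonMultiples m j (≤-trans (n≤1+n _) (≤-trans (∣⇒≤ d∣x) x<m)) x<m (∈-upTo⁻ y∈) d∣x d∣y)
  where
  x<m = ∈-upTo⁻ x∈

-- Pairs with a common factor take up at most two thirds of the square. Adding 2 m² to both sides
-- expresses this without subtraction.
square≤pairs : ∀ m → m * m ≤ 3 * (length (pairs m 0) + length (pairs m 1))
square≤pairs m = +-cancelʳ-≤ (2 * (m * m)) (m * m) (3 * (E + O)) (begin
  m * m + 2 * (m * m)      ≡⟨⟩
  3 * (m * m)              ≤⟨ *-monoʳ-≤ 3 covered ⟩
  3 * (E + O + C)          ≡⟨ *-distribˡ-+ 3 (E + O) C ⟩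
  3 * (E + O) + 3 * C      ≤⟨ +-monoʳ-≤ (3 * (E + O)) (commonMultiples-bound m m) ⟩
  3 * (E + O) + 2 * (m * m) ∎)
  where
  open ≤-Reasoning
  E = length (pairs m 0)
  O = length (pairs m 1)
  C = length (commonMultiples m m)
  covered : m * m ≤ E + O + C
  covered = begin
    m * m             ≡⟨ length-square m ⟨
    length (square m) ≤⟨ length-⊆ (Unique.cartesianProduct⁺ (Unique.upTo⁺ m) (Unique.upTo⁺ m)) (square-covered m) ⟩
    length ((pairs m 0 ++ pairs m 1) ++ commonMultiples m m)
      ≡⟨ trans (length-++ (pairs m 0 ++ pairs m 1)) (cong (_+ C) (length-++ (pairs m 0))) ⟩
    E + O + C ∎

-- The larger of the two parity classes contains at least half of the coprime pairs, which turns the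
-- factor 3 into 6.
many-pairs : ∀ m → ∃[ r ] m * m ≤ 6 * length (pairs m r)
many-pairs m = bound (≤-total E O)
  where
  E = length (pairs m 0)
  O = length (pairs m 1)
  double : ∀ l → 3 * (l + l) ≡ 6 * l
  double = solve-∀
  bound : E ≤ O ⊎ O ≤ E → ∃[ r ] m * m ≤ 6 * length (pairs m r)
  bound (inj₁ E≤O) = 1 , ≤-trans (square≤pairs m) (≤-trans (*-monoʳ-≤ 3 (+-monoˡ-≤ O E≤O)) (≤-reflexive (double O)))
  bound (inj₂ O≤E) = 0 , ≤-trans (square≤pairs m) (≤-trans (*-monoʳ-≤ 3 (+-monoʳ-≤ E O≤E)) (≤-reflexive (double E)))

-- Locally solvable tuples from two coprime pairs.

open import Data.Integer as ℤ using (ℤ; +_; -[1+_]; ∣_∣)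
import Data.Integer.Properties as ℤ
import Data.Integer.Divisibility as ℤ
import Data.Integer.Tactic.RingSolver as ℤ

-- Opposite signs on the two pairs settle the sign condition. Both kinds of entries include the
-- shift by one: `-[1+ z ]` is -(1 + z).
signed : (ℕ × ℕ) × (ℕ × ℕ) → Tuple
signed ((x , y) , (z , w)) = + suc x ∷ + suc y ∷ -[1+ z ] ∷ -[1+ w ] ∷ []

signed-injective : ∀ {s t} → signed s ≡ signed t → s ≡ t
signed-injective refl = refl

signed-prim : ∀ x y z w → Coprime (suc x) (suc y) → Prim (signed ((x , y) , (z , w)))
signed-prim x y z w cop = entries≢0 , cong +_ (begin
  gcd (gcd (gcd (suc x) (suc y)) (suc z)) (suc w)
    ≡⟨ cong (λ g → gcd (gcd g (suc z)) (suc w)) (coprime⇒gcd≡1 cop) ⟩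
  gcd (gcd 1 (suc z)) (suc w) ≡⟨ cong (λ g → gcd g (suc w)) (gcd-zeroˡ (suc z)) ⟩
  gcd 1 (suc w)               ≡⟨ gcd-zeroˡ (suc w) ⟩
  1                           ∎)
  where
  open ≡-Reasoning
  entries≢0 : ∀ i → ¬ (signed ((x , y) , (z , w)) ⟦ i ⟧ ≡ + 0)
  entries≢0 zero                   ()
  entries≢0 (suc zero)             ()
  entries≢0 (suc (suc zero))       ()
  entries≢0 (suc (suc (suc zero))) ()

signed-locSolv : ∀ {r} x y z w → Pair r (x , y) → Pair r (z , w) → LocSolv (signed ((x , y) , (z , w)))
signed-locSolv {r} x y z w (cop , 2∣xy) (cop′ , 2∣zw) =
  (suc (suc zero) , zero , ℤ.-<+ , ℤ.+<+ z<s) ,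
  λ p pp → solvable pp (+ suc x) (+ suc y) -[1+ z ] -[1+ w ] even (coprime-∤ pp cop) (coprime-∤ pp cop′)
  where
  coprime-∤ : ∀ {p m n} → Prime p → Coprime m n → ¬ ((p ∣ m) × (p ∣ n))
  coprime-∤ pp cop p∣both = prime∤1 pp (subst (_∣ 1) (sym (cop p∣both)) ∣-refl)
  identity : ∀ r x y z w → (r ℤ.+ (x ℤ.+ y)) ℤ.- (r ℤ.+ (z ℤ.+ w)) ≡
             (ℤ.1ℤ ℤ.+ x) ℤ.+ (ℤ.1ℤ ℤ.+ y) ℤ.+ ℤ.- (ℤ.1ℤ ℤ.+ z) ℤ.+ ℤ.- (ℤ.1ℤ ℤ.+ w)
  identity = ℤ.solve-∀
  -- Subtracting the parity conditions of the two pairs cancels r, and the shifts by one cancel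
  -- between positive and negative entries.
  even : + 2 ℤ.∣ + suc x ℤ.+ + suc y ℤ.+ -[1+ z ] ℤ.+ -[1+ w ]
  even = subst (+ 2 ℤ.∣_) (identity (+ r) (+ x) (+ y) (+ z) (+ w))
           (∣-− (+ (r + (x + y))) (+ (r + (z + w))) 2∣xy 2∣zw)

signed-box : ∀ {m N} x y z w → 4 * (m * m) ≤ N → x < m → y < m → z < m → w < m →
             BoxN N (signed ((x , y) , (z , w)))
signed-box {m} {N} x y z w 4m²≤N x<m y<m z<m w<m = ℤ.+≤+ (begin
  suc x * suc x + suc y * suc y + suc z * suc z + suc w * suc w
    ≤⟨ +-mono-≤ (+-mono-≤ (+-mono-≤ (*-mono-≤ x<m x<m) (*-mono-≤ y<m y<m)) (*-mono-≤ z<m z<m)) (*-mono-≤ w<m w<m) ⟩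
  m * m + m * m + m * m + m * m ≡⟨ quadruple (m * m) ⟩
  4 * (m * m)                   ≤⟨ 4m²≤N ⟩
  N                             ∎)
  where
  open ≤-Reasoning
  quadruple : ∀ k → k + k + k + k ≡ 4 * k
  quadruple = solve-∀

signed-𝕃loc : ∀ {m N r s} → 4 * (m * m) ≤ N → s ∈ cartesianProduct (pairs m r) (pairs m r) → 𝕃loc N (signed s)
signed-𝕃loc {m} {N} {r} {(x , y) , (z , w)} 4m²≤N s∈ =
  let xy∈ , zw∈             = ∈-cartesianProduct⁻ (pairs m r) (pairs m r) s∈
      x<m , y<m , xy-pair   = ∈-pairs⁻ {m} {r} xy∈
      z<m , w<m , zw-pair   = ∈-pairs⁻ {m} {r} zw∈
  in (signed-prim x y z w (proj₁ xy-pair) , signed-locSolv {r} x y z w xy-pair zw-pair) ,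
     signed-box x y z w 4m²≤N x<m y<m z<m w<m

-- Since `signed` is injective, each choice of two pairs from the same class contributes its own
-- tuple.
𝕃loc-lower : ∀ {m N k} r → 4 * (m * m) ≤ N → HasCard (𝕃loc N) k → length (pairs m r) * length (pairs m r) ≤ k
𝕃loc-lower {m} {N} {k} r 4m²≤N (xs , _ , spec , refl) = begin
  length P * length P                     ≡⟨ length-cartesianProductWith _,_ P P ⟨
  length (cartesianProduct P P)              ≡⟨ length-map signed (cartesianProduct P P) ⟨
  length (map signed (cartesianProduct P P)) ≤⟨ length-⊆ unique included ⟩
  length xs                                  ∎
  where
  open ≤-Reasoning
  P = pairs m r
  unique = Unique.map⁺ signed-injective (Unique.cartesianProduct⁺ (pairs-unique m r) (pairs-unique m r))
  included : ∀ {a} → a ∈ map signed (cartesianProduct P P) → a ∈ xs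
  included a∈ with ∈-map⁻ signed a∈
  ... | s , s∈ , refl = Equivalence.from (spec (signed s)) (signed-𝕃loc {m} {N} {r} 4m²≤N s∈)

-- Counting integer tuples of bounded norm.

vecs : ∀ {a} {A : Set a} n → List A → List (Vec A n)
vecs zero    xs = [] ∷ []
vecs (suc n) xs = cartesianProductWith _∷_ xs (vecs n xs)

length-vecs : ∀ {a} {A : Set a} n (xs : List A) → length (vecs n xs) ≡ length xs ^ n
length-vecs zero    xs = refl
length-vecs (suc n) xs = trans (length-cartesianProductWith _∷_ xs (vecs n xs)) (cong (length xs *_) (length-vecs n xs))

∈-vecs : ∀ {a} {A : Set a} {n} {xs : List A} (v : Vec A n) → (∀ i → lookup v i ∈ xs) → v ∈ vecs n xs
∈-vecs []      _  = here refl
∈-vecs (x ∷ v) v∈ = ∈-cartesianProductWith⁺ _∷_ (v∈ zero) (∈-vecs v (v∈ ∘ suc))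

interval : ℕ → List ℤ
interval b = map +_ (upTo (suc b)) ++ map -[1+_] (upTo b)

length-interval : ∀ b → length (interval b) ≡ suc b + b
length-interval b = trans (length-++ (map +_ (upTo (suc b))))
  (cong₂ _+_ (trans (length-map +_ (upTo (suc b))) (length-upTo (suc b)))
             (trans (length-map -[1+_] (upTo b)) (length-upTo b)))

∈-interval : ∀ {b} i → ∣ i ∣ ≤ b → i ∈ interval b
∈-interval     (+ n)    n≤b = ∈-++⁺ˡ (∈-map⁺ +_ (∈-upTo⁺ (s≤s n≤b)))
∈-interval {b} -[1+ n ] n<b = ∈-++⁺ʳ (map +_ (upTo (suc b))) (∈-map⁺ -[1+_] (∈-upTo⁺ n<b))

i*i≡+∣i∣² : ∀ i → i ℤ.* i ≡ + (∣ i ∣ * ∣ i ∣)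
i*i≡+∣i∣² (+ n)    = sym (ℤ.pos-* n n)
i*i≡+∣i∣² -[1+ n ] = refl

normSq-abs : ∀ a b c d → normSq (a ∷ b ∷ c ∷ d ∷ []) ≡
             + (∣ a ∣ * ∣ a ∣ + ∣ b ∣ * ∣ b ∣ + ∣ c ∣ * ∣ c ∣ + ∣ d ∣ * ∣ d ∣)
normSq-abs a b c d rewrite i*i≡+∣i∣² a | i*i≡+∣i∣² b | i*i≡+∣i∣² c | i*i≡+∣i∣² d = refl

∣i∣²≤normSq : ∀ {N} a i → BoxN N a → ∣ lookup a i ∣ * ∣ lookup a i ∣ ≤ N
∣i∣²≤normSq {N} (a ∷ b ∷ c ∷ d ∷ []) i inBox = ≤-trans (summand i) (ℤ.drop‿+≤+ (subst (ℤ._≤ + N) (normSq-abs a b c d) inBox))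
  where
  A = ∣ a ∣ * ∣ a ∣
  B = ∣ b ∣ * ∣ b ∣
  C = ∣ c ∣ * ∣ c ∣
  D = ∣ d ∣ * ∣ d ∣
  summand : ∀ i → ∣ lookup (a ∷ b ∷ c ∷ d ∷ []) i ∣ * ∣ lookup (a ∷ b ∷ c ∷ d ∷ []) i ∣ ≤ A + B + C + D
  summand zero                   = ≤-trans (m≤m+n A B) (≤-trans (m≤m+n (A + B) C) (m≤m+n (A + B + C) D))
  summand (suc zero)             = ≤-trans (m≤n+m B A) (≤-trans (m≤m+n (A + B) C) (m≤m+n (A + B + C) D))
  summand (suc (suc zero))       = ≤-trans (m≤n+m C (A + B)) (m≤m+n (A + B + C) D)
  summand (suc (suc (suc zero))) = m≤n+m D (A + B + C)

-- A single coordinate of absolute value above b would already make the squared norm at least (1 +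
-- b)², so all tuples lie in the cube with coordinates from -b to b.
𝕃-upper : ∀ {b N l} → N < suc b * suc b → HasCard (𝕃 N) l → l ≤ (suc b + b) ^ 4
𝕃-upper {b} {N} N<[1+b]² (xs , unique , spec , refl) = begin
  length xs                   ≤⟨ length-⊆ unique (λ {a} a∈ → included a (proj₂ (Equivalence.to (spec a) a∈))) ⟩
  length (vecs 4 (interval b)) ≡⟨ length-vecs 4 (interval b) ⟩
  length (interval b) ^ 4      ≡⟨ cong (_^ 4) (length-interval b) ⟩
  (suc b + b) ^ 4              ∎
  where
  open ≤-Reasoning
  included : ∀ a → BoxN N a → a ∈ vecs 4 (interval b)
  included a inBox = ∈-vecs {xs = interval b} a λ i → ∈-interval {b} (lookup a i) (≮⇒≥ λ b<∣aᵢ∣ →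
    <⇒≱ {N} {suc b * suc b} N<[1+b]² (≤-trans (*-mono-≤ b<∣aᵢ∣ b<∣aᵢ∣) (∣i∣²≤normSq a i inBox)))

-- Comparison of the two counts.

-- The witness is the floor of half the square root of N: the largest m for which four entries of
-- size m still fit into the box. When N grows by one, m grows by at most one.
half-sqrt : ∀ N → ∃[ m ] (4 * (m * m) ≤ N × N < 4 * (suc m * suc m))
half-sqrt zero = 0 , z≤n , z<s
half-sqrt (suc N) with half-sqrt N
... | m , lower , upper with suc N <? 4 * (suc m * suc m)
...   | yes upper′ = m , m≤n⇒m≤1+n lower , upper′
...   | no ¬upper  = suc m , ≮⇒≥ ¬upper ,
        <-≤-trans (s≤s upper) (*-monoʳ-< 4 (*-mono-< (n<1+n (suc m)) (n<1+n (suc m))))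

-- Eliminates m: the fourth power is the square of m², which is controlled by the number p of pairs,
-- and p² is controlled by k.
combine-bounds : ∀ s t m p k l → l ≤ (s * m) ^ 4 → m * m ≤ t * p → p * p ≤ k → l ≤ s ^ 4 * t ^ 2 * k
combine-bounds s t m p k l l≤[sm]⁴ m²≤tp p²≤k = begin
  l                             ≤⟨ l≤[sm]⁴ ⟩
  (s * m) ^ 4                   ≡⟨ split s m ⟩
  s ^ 4 * (m * m * (m * m))     ≤⟨ *-monoʳ-≤ (s ^ 4) (*-mono-≤ m²≤tp m²≤tp) ⟩
  s ^ 4 * (t * p * (t * p))     ≡⟨ merge (s ^ 4) t p ⟩
  s ^ 4 * t ^ 2 * (p * p)       ≤⟨ *-monoʳ-≤ (s ^ 4 * t ^ 2) p²≤k ⟩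
  s ^ 4 * t ^ 2 * k             ∎
  where
  open ≤-Reasoning
  split : ∀ s m → s * m * (s * m * (s * m * (s * m * 1))) ≡ s * (s * (s * (s * 1))) * (m * m * (m * m))
  split = solve-∀
  merge : ∀ s t p → s * (t * p * (t * p)) ≡ s * (t * (t * 1)) * (p * p)
  merge = solve-∀

𝕃-upper-7m : ∀ {m N l} → 1 ≤ m → N < 4 * (suc m * suc m) → HasCard (𝕃 N) l → l ≤ (7 * m) ^ 4
𝕃-upper-7m {m} {N} {l} 1≤m upper card = begin
  -- The bound on coordinates is b = 2 m + 1, because 4 (m + 1)² = (2 m + 2)². The width 2 b + 1 = 4
  -- m + 3 is then at most 7 m, as 1 ≤ m.
  l                                     ≤⟨ 𝕃-upper {suc (2 * m)} (<-≤-trans upper (≤-reflexive (fourfold m))) card ⟩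
  (suc (suc (2 * m)) + suc (2 * m)) ^ 4 ≡⟨ cong (_^ 4) (width m) ⟩
  (4 * m + 3 * 1) ^ 4                   ≤⟨ ^-monoˡ-≤ 4 (+-monoʳ-≤ (4 * m) (*-monoʳ-≤ 3 1≤m)) ⟩
  (4 * m + 3 * m) ^ 4                   ≡⟨ cong (_^ 4) (*-distribʳ-+ m 4 3) ⟨
  (7 * m) ^ 4                           ∎
  where
  open ≤-Reasoning
  width : ∀ m → suc (suc (2 * m)) + suc (2 * m) ≡ 4 * m + 3 * 1
  width = solve-∀
  fourfold : ∀ m → 4 * (suc m * suc m) ≡ suc (suc (2 * m)) * suc (suc (2 * m))
  fourfold = solve-∀

theorem1p2 : ∃[ num ] ∃[ den ] ((0 < num) × (0 < den) × ∃[ N₀ ] (∀ N → N₀ ≤ N → ∀ k l → HasCard (𝕃loc N) k → HasCard (𝕃 N) l → num * l ≤ den * k))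
-- The 7 comes from the width of the cube and the 6 from the share of pairs in the chosen parity
-- class. The threshold 4 excludes m = 0, which would force N < 4.
theorem1p2 = 1 , 7 ^ 4 * 6 ^ 2 , z<s , z<s , 4 , bound
  where
  bound : ∀ N → 4 ≤ N → ∀ k l → HasCard (𝕃loc N) k → HasCard (𝕃 N) l → 1 * l ≤ 7 ^ 4 * 6 ^ 2 * k
  bound N 4≤N k l cardₖ cardₗ with half-sqrt N
  ... | zero      , _     , N<4   = contradiction 4≤N (<⇒≱ N<4)
  ... | m@(suc _) , lower , upper with many-pairs m
  ...   | r , m²≤6p = subst (_≤ 7 ^ 4 * 6 ^ 2 * k) (sym (*-identityˡ l))
    (combine-bounds 7 6 m (length (pairs m r)) k l (𝕃-upper-7m (s≤s z≤n) upper cardₗ) m²≤6p (𝕃loc-lower {m} r lower cardₖ))
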